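{- Let $V$ be the set of integer points $(x,y,z)\in\mathbb{Z}^3$ such that none of $x+y,\ x-y,\ y+z,\ y-z,\ z+x,\ z-x$ is congruent to $0 \pmod 4$, and let $G$ be the graph (the sodalite network) with vertex set $V$ in which two vertices are adjacent exactly when their Euclidean distance is $\sqrt{2}$. Let $O=(0,1,2)$ and, for $P\in V$, let $\operatorname{dis}(P)$ denote the graph distance in $G$ from $O$ to $P$. Define $h:V\to\mathbb{R}$ as follows. For $P=(x,y,z)\in V$ let $x'\ge y'\ge z'\ge 0$ be the absolute values $|x|,|y|,|z|$ sorted in decreasing order, and put $$h'(P)=x'+\tfrac{y'}{2}-\tfrac{s}{2},\qquad s=a(y' \bmod 4)\cdot b(x' \bmod 4),$$ where $(a(0),a(1),a(2),a(3))=(0,1,0,-1)$ and $(b(0),b(1),b(2),b(3))=(1,0,-1,0)$. Then $h(P)=h'(P)+c(P)$, where, writing $\operatorname{sig}$ for the sign function, $c(P)=0$ if $|x|\ge|y|\ge|z|$; $c(P)=-\operatorname{sig}(z)$ if $|x|\ge|z|\ge|y|$; $c(P)=-\operatorname{sig}(y)$ if $|y|\ge|x|\ge|z|$; $c(P)=0$ if $|y|\ge|z|\ge|x|$ and $yz\le 0$; $c(P)=-2\operatorname{sig}(z)$ if $|y|\ge|z|\ge|x|$ and $yz\ge 0$; $c(P)=-2\operatorname{sig}(z)$ if $|z|\ge|x|\ge|y|$; $c(P)=-\operatorname{sig}(z)$ if $|z|\ge|y|\ge|x|$ and $yz\le 0$; $c(P)=-3\operatorname{sig}(y)$ if $|z|\ge|y|\ge|x|$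 and $yz\ge 0$. Then $\operatorname{dis}(P)=h(P)$ for every $P\in V$.
   Context: $G$ is the edge-skeleton of the uniform tiling of Euclidean 3-space by truncated octahedra, scaled by a factor 4 so that vertices have integer coordinates; each vertex has exactly four neighbours (e.g. the neighbours of $(0,1,2)$ are $(0,2,1),(0,2,3),(1,0,2),(-1,0,2)$). For vertices in $V$ the absolute values $|x|,|y|,|z|$ are pairwise distinct, so exactly one case of the definition of $c(P)$ applies and the relevant signs are of nonzero coordinates. -}

module Defs where

open import Data.Bool.Base using (if_then_else_)
open import Data.Fin.Base using (Fin)
open import Data.Integer.Base
  using (ℤ; +_; +0; +[1+_]; -[1+_]; 0ℤ; 1ℤ; -1ℤ; -_; _+_; _-_; _*_; _≤_; ∣_∣)
open import Data.Integer.Divisibility.Signed using (_∣_; _∣?_)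
open import Data.Integer.Properties using (_≤?_)
open import Data.Irrelevant using ([_])
open import Data.Nat.Base as ℕ using (ℕ; suc; _⊔_; _⊓_)
open import Data.Nat.DivMod using (_mod_)
open import Data.Nat.Properties using (_≥?_)
open import Data.Product.Base using (_×_; _,_; ∃-syntax)
open import Data.Rational.Base as ℚ using (ℚ; _/_)
open import Data.Refinement using (Refinement-syntax; _,_; value)
open import Data.Vec.Base using (Vec; []; _∷_; lookup)
open import Level using (Level)
open import Relation.Binary.Construct.Closure.ReflexiveTransitive using (Star; fold)
open import Relation.Binary.Core using (Rel)
open import Relation.Binary.PropositionalEquality.Core using (_≡_)
open import Relation.Nullary.Decidable using (Dec; does; ¬?; _×-dec_; from-yes)
open import Relation.Nullary.Negation.Core using (¬_)

Point : Set
Point = ℤ × ℤ × ℤ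

IsVertex : Point → Set
IsVertex (x , y , z) =
    ¬ (+ 4 ∣ x + y) × ¬ (+ 4 ∣ x - y)
  × ¬ (+ 4 ∣ y + z) × ¬ (+ 4 ∣ y - z)
  × ¬ (+ 4 ∣ z + x) × ¬ (+ 4 ∣ z - x)

isVertex? : (P : Point) → Dec (IsVertex P)
isVertex? (x , y , z) =
        ¬? (+ 4 ∣? x + y) ×-dec ¬? (+ 4 ∣? x - y)
  ×-dec ¬? (+ 4 ∣? y + z) ×-dec ¬? (+ 4 ∣? y - z)
  ×-dec ¬? (+ 4 ∣? z + x) ×-dec ¬? (+ 4 ∣? z - x)

-- The membership proof is irrelevant, so that vertices are equal as soon as
-- their coordinates are.  Nothing is lost, as IsVertex is decidable.
V : Set
V = [ P ∈ Point ∣ IsVertex P ]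

O : V
O = (+ 0 , + 1 , + 2) , [ from-yes (isVertex? (+ 0 , + 1 , + 2)) ]

distance² : Point → Point → ℤ
distance² (x₁ , y₁ , z₁) (x₂ , y₂ , z₂) =
  (x₁ - x₂) * (x₁ - x₂) + (y₁ - y₂) * (y₁ - y₂) + (z₁ - z₂) * (z₁ - z₂)

-- Adjacency in the sodalite network: Euclidean distance √2.
infix 4 _~_
_~_ : Rel V _
P ~ Q = distance² (value P) (value Q) ≡ + 2

module _ {a ℓ : Level} {A : Set a} (_⟶_ : Rel A ℓ) where

  Walk : Rel A _
  Walk = Star _⟶_

  walkLength : ∀ {u v} → Walk u v → ℕ
  walkLength = fold (λ _ _ → ℕ) (λ _ → suc) 0

  IsGraphDistance : A → A → ℕ → Set _
  IsGraphDistance u v n =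
      (∃[ w ] walkLength {u} {v} w ≡ n)
    × ((w : Walk u v) → n ℕ.≤ walkLength w)

sig : ℤ → ℤ
sig +0       = 0ℤ
sig +[1+ _ ] = 1ℤ
sig -[1+ _ ] = -1ℤ

a b : Fin 4 → ℤ
a = lookup (0ℤ ∷ 1ℤ ∷ 0ℤ ∷ -1ℤ ∷ [])
b = lookup (1ℤ ∷ 0ℤ ∷ -1ℤ ∷ 0ℤ ∷ [])

-- x′ and y′ are the largest and the middle one of the three absolute values;
-- the smallest one does not enter the formula.
h′ : Point → ℚ
h′ (x , y , z) = (+ x′ / 1) ℚ.+ (+ y′ / 2) ℚ.- (s / 2)
  where
  X Y Z x′ y′ : ℕ
  X = ∣ x ∣
  Y = ∣ y ∣
  Z = ∣ z ∣
  x′ = X ⊔ Y ⊔ Z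
  y′ = (X ⊓ Y) ⊔ ((X ⊔ Y) ⊓ Z)

  s : ℤ
  s = a (y′ mod 4) * b (x′ mod 4)

-- At a vertex the absolute values of the coordinates are pairwise distinct, so
-- exactly one of the six orderings holds.  When ∣y∣ ≥ ∣z∣ ≥ ∣x∣ or
-- ∣z∣ ≥ ∣y∣ ≥ ∣x∣, moreover y * z ≢ 0.  Hence the order in which the clauses are
-- tried is immaterial there, and the final `else` is the remaining clause
-- Z ≥ Y ≥ X with 0 ≤ y * z.
c : Point → ℤ
c (x , y , z) =
  if      does (X ≥≥? Y , Z)                          then 0ℤ
  else if does (X ≥≥? Z , Y)                          then - sig z
  else if does (Y ≥≥? X , Z)                          then - sig y
  else if does ((Y ≥≥? Z , X) ×-dec (y * z ≤? 0ℤ))    then 0ℤ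
  else if does ((Y ≥≥? Z , X) ×-dec (0ℤ ≤? y * z))    then - (+ 2 * sig z)
  else if does (Z ≥≥? X , Y)                          then - (+ 2 * sig z)
  else if does ((Z ≥≥? Y , X) ×-dec (y * z ≤? 0ℤ))    then - sig z
  else                                                     - (+ 3 * sig y)
  where
  X Y Z : ℕ
  X = ∣ x ∣
  Y = ∣ y ∣
  Z = ∣ z ∣

  infix 5 _≥≥?_,_
  _≥≥?_,_ : ∀ k m n → Dec (k ℕ.≥ m × m ℕ.≥ n)
  k ≥≥? m , n = (k ≥? m) ×-dec (m ≥? n)

-- All values are rational, so ℚ replaces the codomain ℝ.
h : V → ℚ
h P = h′ (value P) ℚ.+ (c (value P) / 1)

{-# OPTIONS --safe #-}
module Submission where

-- Up to permuting coordinates and changing signs, a vertex is a descending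
-- triple x > y > z of naturals.  There h′ is the natural number `height`, and
-- c + 3 is the `level` of the chamber: the distance from O, within the
-- truncated octahedron around the origin, of the permutation of (±2, ±1, 0)
-- lying in that chamber.  Every descending triple other than (2, 1, 0) has a
-- neighbour of smaller height in its chamber, so some walk from O attains h.
-- Conversely, an edge either stays in its chamber and changes the height by at
-- most 1, or swaps two coordinates and then keeps the height and changes the
-- level by at most 1, so no walk is shorter.  Both local facts survive adding 4
-- to the largest, to the two largest or to all coordinates once the gap being
-- widened is at least 4, which leaves finitely many triples to check.

open import Defs
open import Data.Bool.Base using (if_then_else_)
open import Data.Integer.Base as ℤ
  using (ℤ; +_; +0; +[1+_]; -[1+_]; 0ℤ; 1ℤ; -1ℤ; -_; _+_; _-_; _*_; ∣_∣; sign; _◃_)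
open import Data.Integer.Divisibility.Signed as ℤ∣ using (_∣_; divides)
import Data.Integer.Properties as ℤ
import Data.Integer.Tactic.RingSolver as ℤ-Solver
open import Data.Irrelevant using ([_])
open import Data.Nat.Base as ℕ using (ℕ; zero; suc; s≤s)
open import Data.Nat.DivMod using (_mod_)
import Data.Nat.Properties as ℕ
open import Data.Product.Base using (_×_; _,_; ∃-syntax; Σ-syntax; proj₁; proj₂)
open import Data.Product.Properties using (≡-dec)
open import Data.Rational.Base as ℚ using (_/_; toℚᵘ)
import Data.Rational.Properties as ℚ
open import Data.Rational.Unnormalised.Base using (mkℚᵘ; *≡*; _≃_)
import Data.Rational.Unnormalised.Properties as ℚᵘ
open import Data.Refinement using (_,_; value)
open import Data.Sign.Base as Sign using (Sign)
open import Data.Sum.Base as Sum using (_⊎_; inj₁; inj₂)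
open import Function.Base using (_∘_)
open import Relation.Binary.Construct.Closure.ReflexiveTransitive using (ε; _◅_; _◅◅_)
open import Relation.Binary.Definitions using (tri<; tri≈; tri>)
open import Relation.Binary.PropositionalEquality
open import Relation.Nullary.Decidable
  using (Dec; does; yes; no; ¬?; map′; _×-dec_; _⊎-dec_; _→-dec_;
         from-yes; recompute; dec-true; dec-false)
open import Relation.Nullary.Negation.Core using (¬_; contradiction)

-- Turns and heights of triples of naturals

Triple : Set → Set
Triple A = A × A × A

data Dir : Set where
  outward inward : Dir

data Turn : Set where
  xy xz yz : Dir → Dir → Turn

turn : {A : Set} → (Dir → A → A) → Turn → Triple A → Triple A
turn f (xy d e) (x , y , z) = f d x , f e y , z
turn f (xz d e) (x , y , z) = f d x , y , f e z
turn f (yz d e) (x , y , z) = x , f d y , f e z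

-- The effect of a unit step on absolute values: both neighbours of 0 have
-- absolute value 1.
goℕ : Dir → ℕ → ℕ
goℕ outward n       = suc n
goℕ inward  zero    = 1
goℕ inward  (suc n) = n

-- The residue modulo 4, up to sign.
residueClass : ℕ → ℕ
residueClass 0 = 0
residueClass 1 = 1
residueClass 2 = 2
residueClass 3 = 1
residueClass (suc (suc (suc (suc n)))) = residueClass n

Distinct : Triple ℕ → Set
Distinct (x , y , z) = x ≢ y × y ≢ z × z ≢ x

residueClasses : Triple ℕ → Triple ℕ
residueClasses (x , y , z) = residueClass x , residueClass y , residueClass z

Vertexℕ : Triple ℕ → Set
Vertexℕ t = Distinct (residueClasses t)

Descending : Triple ℕ → Set
Descending (x , y , z) = y ℕ.< x × z ℕ.< y

isTwoMod4 : ℕ → ℕ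
isTwoMod4 0 = 0
isTwoMod4 1 = 0
isTwoMod4 2 = 1
isTwoMod4 3 = 0
isTwoMod4 (suc (suc (suc (suc n)))) = isTwoMod4 n

-- (y − s) / 2 in the notation of h′; meaningless when x and y are both odd.
half : ℕ → ℕ → ℕ
half x 0 = 0
half x 1 = isTwoMod4 x
half x 2 = 1
half x 3 = 2 ℕ.∸ isTwoMod4 x
half x (suc (suc (suc (suc y)))) = 2 ℕ.+ half x y

height : Triple ℕ → ℕ
height (x , y , _) = x ℕ.+ half x y

-- Shifts by 4 and induction on the gaps

shift₁ shift₂ shift₃ : Triple ℕ → Triple ℕ
shift₁ (x , y , z) = 4 ℕ.+ x , y , z
shift₂ (x , y , z) = 4 ℕ.+ x , 4 ℕ.+ y , z
shift₃ (x , y , z) = 4 ℕ.+ x , 4 ℕ.+ y , 4 ℕ.+ z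

half-shift : ∀ x y → half (4 ℕ.+ x) y ≡ half x y
half-shift x 0 = refl
half-shift x 1 = refl
half-shift x 2 = refl
half-shift x 3 = refl
half-shift x (suc (suc (suc (suc y)))) = cong (2 ℕ.+_) (half-shift x y)

-- False at 0, where an inward step goes to 1, whereas it takes 4 to 3. Only positive coordinates
-- may therefore be shifted.
goℕ-+4 : ∀ d n → goℕ d (4 ℕ.+ suc n) ≡ 4 ℕ.+ goℕ d (suc n)
goℕ-+4 outward n = refl
goℕ-+4 inward  n = refl

Descent : Triple ℕ → Set
Descent t = ∃[ m ] Vertexℕ (turn goℕ m t) × Descending (turn goℕ m t)
                 × height t ≡ suc (height (turn goℕ m t))

-- All descending triples, parametrised by unconstrained naturals.
withGaps : ℕ → ℕ → ℕ → Triple ℕ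
withGaps p q z = suc (p ℕ.+ suc (q ℕ.+ z)) , suc (q ℕ.+ z) , z

+4 : ∀ m n → m ℕ.+ (4 ℕ.+ n) ≡ 4 ℕ.+ (m ℕ.+ n)
+4 m n = trans (sym (ℕ.+-assoc m 4 n))
               (trans (cong (ℕ._+ n) (ℕ.+-comm m 4)) (ℕ.+-assoc 4 m n))

withGaps-+4₂ : ∀ p q z → withGaps p (4 ℕ.+ q) z ≡ shift₂ (withGaps p q z)
withGaps-+4₂ p q z = cong (λ x → suc x , 5 ℕ.+ (q ℕ.+ z) , z) (+4 p (suc (q ℕ.+ z)))

withGaps-+4₃ : ∀ p q z → withGaps p q (4 ℕ.+ z) ≡ shift₃ (withGaps p q z)
withGaps-+4₃ p q z rewrite +4 q z =
  cong (λ x → suc x , 5 ℕ.+ (q ℕ.+ z) , 4 ℕ.+ z) (+4 p (suc (q ℕ.+ z)))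

-- What a descent or an edge outcome needs in order to be carried from `t` to `f t`. Commutation
-- with turns is required at `t` only, since it can fail when a shifted coordinate is 0.
record Shift (f : Triple ℕ → Triple ℕ) (t : Triple ℕ) : Set where
  field
    amount     : ℕ
    turn-comm  : ∀ m → turn goℕ m (f t) ≡ f (turn goℕ m t)
    residues   : ∀ s → residueClasses (f s) ≡ residueClasses s
    descending : ∀ s → Descending s → Descending (f s)
    height-+   : ∀ s → height (f s) ≡ amount ℕ.+ height s

isShift₁ : ∀ p q z → Shift shift₁ (withGaps p q z)
isShift₁ p q z = record
  { amount     = 4
  ; turn-comm  = λ where
      (xy d e) → cong (_, _) (goℕ-+4 d _)
      (xz d e) → cong (_, _) (goℕ-+4 d _)
      (yz d e) → refl
  ; residues   = λ _ → refl
  ; descending = λ (_ , _ , _) (y<x , z<y) → ℕ.m≤n⇒m≤o+n 4 y<x , z<y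
  ; height-+   = λ (x , y , _) → cong (λ n → 4 ℕ.+ (x ℕ.+ n)) (half-shift x y)
  }

-- The largest coordinate contributes 4 and the middle one, which counts half, contributes 2. The
-- smallest does not enter the height, so `shift₃` adds 6 as well.
height-shift₂ : ∀ x y → 4 ℕ.+ x ℕ.+ half (4 ℕ.+ x) (4 ℕ.+ y) ≡ 6 ℕ.+ (x ℕ.+ half x y)
height-shift₂ x y rewrite half-shift x y =
  cong (4 ℕ.+_) (trans (ℕ.+-suc x _) (cong suc (ℕ.+-suc x _)))

isShift₂ : ∀ p q z → Shift shift₂ (withGaps p q z)
isShift₂ p q z = record
  { amount     = 6
  ; turn-comm  = λ where
      (xy d e) → cong₂ (λ x y → x , y , z) (goℕ-+4 d _) (goℕ-+4 e _)
      (xz d e) → cong (_, _) (goℕ-+4 d _)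
      (yz d e) → cong (λ y → _ , y , goℕ e z) (goℕ-+4 d _)
  ; residues   = λ _ → refl
  ; descending = λ (_ , _ , _) (y<x , z<y) → ℕ.+-monoʳ-< 4 y<x , ℕ.m≤n⇒m≤o+n 4 z<y
  ; height-+   = λ (x , y , _) → height-shift₂ x y
  }

isShift₃ : ∀ p q z → Shift shift₃ (withGaps p q (suc z))
isShift₃ p q z = record
  { amount     = 6
  ; turn-comm  = λ where
      (xy d e) → cong₂ (λ x y → x , y , 5 ℕ.+ z) (goℕ-+4 d _) (goℕ-+4 e _)
      (xz d e) → cong₂ (λ x w → x , 5 ℕ.+ (q ℕ.+ suc z) , w) (goℕ-+4 d _) (goℕ-+4 e z)
      (yz d e) → cong₂ (λ y w → 5 ℕ.+ (p ℕ.+ suc (q ℕ.+ suc z)) , y , w) (goℕ-+4 d _) (goℕ-+4 e z)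
  ; residues   = λ _ → refl
  ; descending = λ (_ , _ , _) (y<x , z<y) → ℕ.+-monoʳ-< 4 y<x , ℕ.+-monoʳ-< 4 z<y
  ; height-+   = λ (x , y , _) → height-shift₂ x y
  }

-- The step starts only from arguments of at least 4, where zero gaps and zero coordinates can no
-- longer interfere. Hence the base covers two periods of length 4.
shift-induction : (P : ℕ → Set) → (∀ {n} → n ℕ.< 8 → P n) →
                  (∀ n → P (4 ℕ.+ n) → P (8 ℕ.+ n)) → ∀ n → P n
shift-induction P base step n with n ℕ.<? 8
... | yes n<8 = base n<8
... | no  n≮8 = subst P (ℕ.m+[n∸m]≡n (ℕ.≮⇒≥ n≮8)) (from8 (n ℕ.∸ 8))
  where
  from8 : ∀ k → P (8 ℕ.+ k)
  from8 0 = step 0 (base (from-yes (4 ℕ.<? 8)))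
  from8 1 = step 1 (base (from-yes (5 ℕ.<? 8)))
  from8 2 = step 2 (base (from-yes (6 ℕ.<? 8)))
  from8 3 = step 3 (base (from-yes (7 ℕ.<? 8)))
  from8 (suc (suc (suc (suc k)))) = step (4 ℕ.+ k) (from8 k)

gap-induction : (P : ℕ → ℕ → ℕ → Set) →
  (∀ {p} → p ℕ.< 8 → ∀ {q} → q ℕ.< 8 → ∀ {z} → z ℕ.< 8 → P p q z) →
  (∀ p q z → P (4 ℕ.+ p) q z → P (8 ℕ.+ p) q z) →
  (∀ p q z → P p (4 ℕ.+ q) z → P p (8 ℕ.+ q) z) →
  (∀ p q z → P p q (4 ℕ.+ z) → P p q (8 ℕ.+ z)) →
  ∀ p q z → P p q z
gap-induction P base step₁ step₂ step₃ p q z =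
  shift-induction (λ p → P p q z)
    (λ {p} p<8 → shift-induction (λ q → P p q z)
      (λ {q} q<8 → shift-induction (P p q) (base p<8 q<8) (step₃ p q) z)
      (λ q → step₂ p q z) q)
    (λ p → step₁ p q z) p

-- Decision procedures for the finite checks

_≟³_ : (s t : Triple ℕ) → Dec (s ≡ t)
_≟³_ = ≡-dec ℕ._≟_ (≡-dec ℕ._≟_ ℕ._≟_)

vertexℕ? : ∀ t → Dec (Vertexℕ t)
vertexℕ? _ = ¬? (_ ℕ.≟ _) ×-dec ¬? (_ ℕ.≟ _) ×-dec ¬? (_ ℕ.≟ _)

descending? : ∀ t → Dec (Descending t)
descending? _ = (_ ℕ.<? _) ×-dec (_ ℕ.<? _)

module _ {P : Dir → Set} (P? : ∀ d → Dec (P d)) where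

  allDirs? : Dec (∀ d → P d)
  allDirs? = map′ (λ { (o , i) outward → o ; (o , i) inward → i })
                  (λ f → f outward , f inward) (P? outward ×-dec P? inward)

  anyDir? : Dec (∃[ d ] P d)
  anyDir? = map′ (λ { (inj₁ o) → outward , o ; (inj₂ i) → inward , i })
                 (λ { (outward , o) → inj₁ o ; (inward , i) → inj₂ i }) (P? outward ⊎-dec P? inward)

module _ {P : Turn → Set} (P? : ∀ m → Dec (P m)) where

  allTurns? : Dec (∀ m → P m)
  allTurns? = map′
    (λ { (f , g , h) (xy d e) → f d e ; (f , g , h) (xz d e) → g d e ; (f , g , h) (yz d e) → h d e })
    (λ f → (λ d e → f (xy d e)) , (λ d e → f (xz d e)) , (λ d e → f (yz d e)))
    (allDirs? (λ d → allDirs? λ e → P? (xy d e)) ×-dec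
     allDirs? (λ d → allDirs? λ e → P? (xz d e)) ×-dec
     allDirs? (λ d → allDirs? λ e → P? (yz d e)))

  anyTurn? : Dec (∃[ m ] P m)
  anyTurn? = map′
    (λ { (inj₁ (d , e , p)) → xy d e , p
       ; (inj₂ (inj₁ (d , e , p))) → xz d e , p
       ; (inj₂ (inj₂ (d , e , p))) → yz d e , p })
    (λ { (xy d e , p) → inj₁ (d , e , p)
       ; (xz d e , p) → inj₂ (inj₁ (d , e , p))
       ; (yz d e , p) → inj₂ (inj₂ (d , e , p)) })
    (anyDir? (λ d → anyDir? λ e → P? (xy d e)) ⊎-dec
     anyDir? (λ d → anyDir? λ e → P? (xz d e)) ⊎-dec
     anyDir? (λ d → anyDir? λ e → P? (yz d e)))

-- Descent within a chamber

DescentOrCore : Triple ℕ → Set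
DescentOrCore t = Vertexℕ t → t ≡ (2 , 1 , 0) ⊎ Descent t

-- The turn that lowers `t` also lowers `f t`, as both heights grow by the same amount. The core is
-- excluded because it offers no turn to carry over.
descentOrCore-shift : ∀ {f t} → Shift f t → t ≢ (2 , 1 , 0) →
                      DescentOrCore t → DescentOrCore (f t)
descentOrCore-shift {f} {t} shift t≢core descent vertex-ft
  with descent (subst Distinct (residues t) vertex-ft)
  where open Shift shift
... | inj₁ t≡core           = contradiction t≡core t≢core
... | inj₂ (m , v , d , eq) = inj₂
  ( m
  , subst Vertexℕ (sym (turn-comm m)) (subst Distinct (sym (residues _)) v)
  , subst Descending (sym (turn-comm m)) (descending _ d)
  , (begin
      height (f t)                            ≡⟨ height-+ t ⟩
      amount ℕ.+ height t                     ≡⟨ cong (amount ℕ.+_) eq ⟩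
      amount ℕ.+ suc (height (turn goℕ m t))  ≡⟨ ℕ.+-suc amount _ ⟩
      suc (amount ℕ.+ height (turn goℕ m t))  ≡⟨ cong suc (height-+ _) ⟨
      suc (height (f (turn goℕ m t)))         ≡⟨ cong (suc ∘ height) (turn-comm m) ⟨
      suc (height (turn goℕ m (f t)))         ∎))
  where open Shift shift
        open ≡-Reasoning

-- Abstract, as unfolding the finite check in later types is prohibitively slow.
abstract

  descentOrCore-gaps : ∀ p q z → DescentOrCore (withGaps p q z)
  descentOrCore-gaps = gap-induction (λ p q z → DescentOrCore (withGaps p q z))
    (from-yes (ℕ.allUpTo? (λ p → ℕ.allUpTo? (λ q →
      ℕ.allUpTo? (λ z → check (withGaps p q z)) 8) 8) 8))
    -- Each `λ ()` holds because a gap or a last coordinate of at least 4 is incompatible with (2,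
    -- 1, 0).
    (λ p q z → descentOrCore-shift (isShift₁ (4 ℕ.+ p) q z) λ ())
    (λ p q z D → subst DescentOrCore (sym (withGaps-+4₂ p (4 ℕ.+ q) z))
                   (descentOrCore-shift (isShift₂ p (4 ℕ.+ q) z) (λ ()) D))
    (λ p q z D → subst DescentOrCore (sym (withGaps-+4₃ p q (4 ℕ.+ z)))
                   (descentOrCore-shift (isShift₃ p q (3 ℕ.+ z)) (λ ()) D))
    where
    check : ∀ t → Dec (DescentOrCore t)
    check t = vertexℕ? t →-dec ((t ≟³ (2 , 1 , 0)) ⊎-dec anyTurn? λ m →
      vertexℕ? (turn goℕ m t) ×-dec descending? (turn goℕ m t) ×-dec (_ ℕ.≟ _))

descending⇒gaps : (P : Triple ℕ → Set) → (∀ p q z → P (withGaps p q z)) → ∀ t → Descending t → P t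
descending⇒gaps P hyp (x , y , z) (y<x , z<y)
  with ℕ.m≤n⇒∃[o]m+o≡n z<y
... | q , refl rewrite ℕ.+-comm z q
  with ℕ.m≤n⇒∃[o]m+o≡n y<x
... | p , refl rewrite ℕ.+-comm (suc (q ℕ.+ z)) p = hyp p q z

descentOrCore : ∀ t → Descending t → DescentOrCore t
descentOrCore = descending⇒gaps DescentOrCore descentOrCore-gaps

-- Edges leaving a descending triple

flip₁₂ flip₂₃ : Triple ℕ → Triple ℕ
flip₁₂ (x , y , z) = y , x , z
flip₂₃ (x , y , z) = x , z , y

-- The swaps are tied to the gaps p and q, so that they are vacuous in the
-- inductive steps widening the gap between the swapped coordinates.
GapOutcome : (p q : ℕ) → Triple ℕ → Triple ℕ → Set
GapOutcome p q t t′ =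
    (Descending t′ × height t′ ℕ.≤ suc (height t))
  ⊎ (p ≡ 0 × t′ ≡ flip₁₂ t)
  ⊎ (q ≡ 0 × t′ ≡ flip₂₃ t)

Turns : (p q : ℕ) → Triple ℕ → Set
Turns p q t = Vertexℕ t → ∀ m → Vertexℕ (turn goℕ m t) → GapOutcome p q t (turn goℕ m t)

-- A swap commutes with a shift that moves both or neither of the swapped coordinates. Otherwise the
-- shift widens the gap between them, and the swap is ruled out because that gap is nonzero.
turns-shift : ∀ {f t p q p′ q′} → Shift f t →
  (∀ {t′} → p ≡ 0 × t′ ≡ flip₁₂ t → p′ ≡ 0 × f t′ ≡ flip₁₂ (f t)) →
  (∀ {t′} → q ≡ 0 × t′ ≡ flip₂₃ t → q′ ≡ 0 × f t′ ≡ flip₂₃ (f t)) →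
  Turns p q t → Turns p′ q′ (f t)
turns-shift {f} {t} {p} {q} {p′} {q′} shift swapped₁₂ swapped₂₃ turns v m v′ =
  cases (turns (subst Distinct (residues t) v) m
               (subst Distinct (residues _) (subst Vertexℕ (turn-comm m) v′)))
  where
  open Shift shift
  open ℕ.≤-Reasoning

  cases : GapOutcome p q t (turn goℕ m t) → GapOutcome p′ q′ (f t) (turn goℕ m (f t))
  cases (inj₁ (d , le)) = inj₁
    ( subst Descending (sym (turn-comm m)) (descending _ d)
    , (begin
        height (turn goℕ m (f t))         ≡⟨ cong height (turn-comm m) ⟩
        height (f (turn goℕ m t))         ≡⟨ height-+ _ ⟩
        amount ℕ.+ height (turn goℕ m t)  ≤⟨ ℕ.+-monoʳ-≤ amount le ⟩
        amount ℕ.+ suc (height t)         ≡⟨ ℕ.+-suc amount _ ⟩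
        suc (amount ℕ.+ height t)         ≡⟨ cong suc (height-+ t) ⟨
        suc (height (f t))                ∎))
  cases (inj₂ (inj₁ e)) =
    inj₂ (inj₁ (subst (λ t′ → p′ ≡ 0 × t′ ≡ flip₁₂ (f t)) (sym (turn-comm m)) (swapped₁₂ e)))
  cases (inj₂ (inj₂ e)) =
    inj₂ (inj₂ (subst (λ t′ → q′ ≡ 0 × t′ ≡ flip₂₃ (f t)) (sym (turn-comm m)) (swapped₂₃ e)))

abstract

  -- Coordinates that become equal would violate the residue condition. The order can thus change
  -- only when two consecutive values trade places.
  turns-gaps : ∀ p q z → Turns p q (withGaps p q z)
  turns-gaps = gap-induction (λ p q z → Turns p q (withGaps p q z))
    (from-yes (ℕ.allUpTo? (λ p → ℕ.allUpTo? (λ q →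
      ℕ.allUpTo? (λ z → check p q (withGaps p q z)) 8) 8) 8))
    (λ p q z → turns-shift (isShift₁ (4 ℕ.+ p) q z) (λ ()) λ { (q≡0 , refl) → q≡0 , refl })
    (λ p q z T → subst (Turns p (8 ℕ.+ q)) (sym (withGaps-+4₂ p (4 ℕ.+ q) z))
      (turns-shift (isShift₂ p (4 ℕ.+ q) z) (λ { (p≡0 , refl) → p≡0 , refl }) (λ ()) T))
    (λ p q z T → subst (Turns p q) (sym (withGaps-+4₃ p q (4 ℕ.+ z)))
      (turns-shift (isShift₃ p q (3 ℕ.+ z))
        (λ { (p≡0 , refl) → p≡0 , refl }) (λ { (q≡0 , refl) → q≡0 , refl }) T))
    where
    check : ∀ p q t → Dec (Turns p q t)
    check p q t = vertexℕ? t →-dec allTurns? λ m → let t′ = turn goℕ m t in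
      vertexℕ? t′ →-dec (descending? t′ ×-dec (_ ℕ.≤? _)
                         ⊎-dec (p ℕ.≟ 0) ×-dec (t′ ≟³ _)
                         ⊎-dec (q ℕ.≟ 0) ×-dec (t′ ≟³ _))

Outcome : Triple ℕ → Triple ℕ → Set
Outcome t t′ =
    (Descending t′ × height t′ ℕ.≤ suc (height t))
  ⊎ t′ ≡ flip₁₂ t
  ⊎ t′ ≡ flip₂₃ t

outcome : ∀ t → Descending t → Vertexℕ t → ∀ m → Vertexℕ (turn goℕ m t) →
          Outcome t (turn goℕ m t)
outcome = descending⇒gaps _ λ p q z v m v′ →
  Sum.map₂ (Sum.map proj₂ proj₂) (turns-gaps p q z v m v′)

-- Turns of integer points: absolute values and signs

abs³ : Point → Triple ℕ
abs³ (x , y , z) = ∣ x ∣ , ∣ y ∣ , ∣ z ∣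

-- At 0 the two directions are assigned to 1 and -1 by convention, so that every integer reaches
-- both of its neighbours and `∣go∣` holds without exception.
go : Dir → ℤ → ℤ
go outward (+ n)    = + suc n
go outward -[1+ n ] = -[1+ suc n ]
go inward  +0       = -1ℤ
go inward  +[1+ n ] = + n
go inward  -[1+ n ] = - (+ n)

∣go∣ : ∀ d i → ∣ go d i ∣ ≡ goℕ d ∣ i ∣
∣go∣ outward (+ n)    = refl
∣go∣ outward -[1+ n ] = refl
∣go∣ inward  +0       = refl
∣go∣ inward  +[1+ n ] = refl
∣go∣ inward  -[1+ n ] = ℤ.∣-i∣≡∣i∣ (+ n)

abs³-turn : ∀ m p → abs³ (turn go m p) ≡ turn goℕ m (abs³ p)
abs³-turn (xy d e) (x , y , z) = cong₂ (λ i j → i , j , ∣ z ∣) (∣go∣ d x) (∣go∣ e y)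
abs³-turn (xz d e) (x , y , z) = cong₂ (λ i j → i , ∣ y ∣ , j) (∣go∣ d x) (∣go∣ e z)
abs³-turn (yz d e) (x , y , z) = cong₂ (λ i j → ∣ x ∣ , i , j) (∣go∣ d y) (∣go∣ e z)

-- A unit step cannot jump over 0, so a sign changes only on leaving or reaching 0, which itself has
-- sign `+`.
sign-go : ∀ d i → ∣ i ∣ ≢ 0 → ∣ go d i ∣ ≢ 0 → sign (go d i) ≡ sign i
sign-go outward (+ n)          _   _   = refl
sign-go outward -[1+ n ]       _   _   = refl
sign-go inward  +0             i≢0 _   = contradiction refl i≢0
sign-go inward  +[1+ n ]       _   _   = refl
sign-go inward  -[1+ zero ]    _   j≢0 = contradiction refl j≢0
sign-go inward  -[1+ suc n ]   _   _   = refl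

SameSign : ℤ → ℤ → Set
SameSign i j = ∣ i ∣ ≢ 0 → ∣ j ∣ ≢ 0 → sign j ≡ sign i

turn-sameSign : ∀ m x y z → let (x′ , y′ , _) = turn go m (x , y , z) in SameSign x x′ × SameSign y y′
turn-sameSign (xy d e) x y z = sign-go d x , sign-go e y
turn-sameSign (xz d e) x y z = sign-go d x , λ _ _ → refl
turn-sameSign (yz d e) x y z = (λ _ _ → refl) , sign-go d y

-- Vertices

residueClass-+4 : ∀ i → residueClass ∣ i + + 4 ∣ ≡ residueClass ∣ i ∣
residueClass-+4 (+ n) = cong residueClass (ℕ.+-comm n 4)
residueClass-+4 -[1+ 0 ] = refl
residueClass-+4 -[1+ 1 ] = refl
residueClass-+4 -[1+ 2 ] = refl
residueClass-+4 -[1+ 3 ] = refl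
residueClass-+4 -[1+ suc (suc (suc (suc n))) ] = refl

residueClass-+4* : ∀ n i → residueClass ∣ i + + n * + 4 ∣ ≡ residueClass ∣ i ∣
residueClass-+4* zero    i = cong (residueClass ∘ ∣_∣) (ℤ.+-identityʳ i)
residueClass-+4* (suc n) i = begin
  residueClass ∣ i + + suc n * + 4 ∣      ≡⟨ cong (residueClass ∘ ∣_∣) (regroup i (+ n)) ⟩
  residueClass ∣ (i + + n * + 4) + + 4 ∣  ≡⟨ residueClass-+4 (i + + n * + 4) ⟩
  residueClass ∣ i + + n * + 4 ∣          ≡⟨ residueClass-+4* n i ⟩
  residueClass ∣ i ∣                      ∎
  where
  open ≡-Reasoning
  regroup : ∀ i n → i + (1ℤ + n) * + 4 ≡ (i + n * + 4) + + 4
  regroup = ℤ-Solver.solve-∀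

4∣-⇒residueClass : ∀ i j → + 4 ∣ i - j → residueClass ∣ i ∣ ≡ residueClass ∣ j ∣
4∣-⇒residueClass i j (divides (+ n) eq) =
  trans (cong (residueClass ∘ ∣_∣) (trans (i≡j+[i-j] i j) (cong (λ k → j + k) eq)))
        (residueClass-+4* n j)
  where
  i≡j+[i-j] : ∀ i j → i ≡ j + (i - j)
  i≡j+[i-j] = ℤ-Solver.solve-∀
4∣-⇒residueClass i j (divides -[1+ n ] eq) = sym
  (trans (cong (residueClass ∘ ∣_∣) (trans (j≡i-[i-j] i j) (cong (λ k → i - k) eq)))
         (residueClass-+4* (suc n) i))
  where
  j≡i-[i-j] : ∀ i j → j ≡ i - (i - j)
  j≡i-[i-j] = ℤ-Solver.solve-∀

4∣+⇒residueClass : ∀ i j → + 4 ∣ i + j → residueClass ∣ i ∣ ≡ residueClass ∣ j ∣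
4∣+⇒residueClass i j 4∣i+j =
  trans (4∣-⇒residueClass i (- j) (subst (λ k → + 4 ∣ i + k) (sym (ℤ.neg-involutive j)) 4∣i+j))
        (cong residueClass (ℤ.∣-i∣≡∣i∣ j))

-- The class forgets the sign of the residue, so `i` is congruent to plus or minus its class: 3, for
-- instance, is congruent to -1.
residueClass-spec : ∀ i → let r = + residueClass ∣ i ∣ in (+ 4 ∣ i - r) ⊎ (+ 4 ∣ i + r)
residueClass-spec (+ n) = natural n
  where
  natural : ∀ n → let r = + residueClass n in (+ 4 ∣ + n - r) ⊎ (+ 4 ∣ + n + r)
  natural 0 = inj₁ (divides (+ 0) refl)
  natural 1 = inj₁ (divides (+ 0) refl)
  natural 2 = inj₁ (divides (+ 0) refl)
  natural 3 = inj₂ (divides (+ 1) refl)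
  natural (suc (suc (suc (suc n)))) with natural n
  ... | inj₁ d = inj₁ (subst (+ 4 ∣_) (sym (ℤ.+-assoc (+ 4) (+ n) (- + residueClass n)))
                             (ℤ∣.∣m∣n⇒∣m+n ℤ∣.∣-refl d))
  ... | inj₂ d = inj₂ (subst (+ 4 ∣_) (sym (ℤ.+-assoc (+ 4) (+ n) (+ residueClass n)))
                             (ℤ∣.∣m∣n⇒∣m+n ℤ∣.∣-refl d))
residueClass-spec -[1+ n ] with residueClass-spec (+ suc n)
... | inj₁ d = inj₂ (subst (+ 4 ∣_) (neg (+ suc n) (+ residueClass (suc n))) (ℤ∣.∣m⇒∣-m d))
  where
  neg : ∀ i r → - (i - r) ≡ - i + r
  neg = ℤ-Solver.solve-∀
... | inj₂ d =
  inj₁ (subst (+ 4 ∣_) (ℤ.neg-distrib-+ (+ suc n) (+ residueClass (suc n))) (ℤ∣.∣m⇒∣-m d))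

Apart : ℤ → ℤ → Set
Apart i j = ¬ (+ 4 ∣ i + j) × ¬ (+ 4 ∣ i - j)

-- With a common class r, both `i` and `j` are congruent to r or -r. Then 4 divides their difference
-- if the signs agree and their sum if not. So being a vertex depends on absolute values only.
apart⇒≢ : ∀ i j → Apart i j → residueClass ∣ i ∣ ≢ residueClass ∣ j ∣
apart⇒≢ i j (4∤i+j , 4∤i-j) eq
  with residueClass-spec i
     | subst (λ r → (+ 4 ∣ j - + r) ⊎ (+ 4 ∣ j + + r)) (sym eq) (residueClass-spec j)
... | inj₁ d | inj₁ e = 4∤i-j (subst (+ 4 ∣_) (lemma i j _) (ℤ∣.∣m∣n⇒∣m-n d e))
  where lemma : ∀ i j r → (i - r) - (j - r) ≡ i - j
        lemma = ℤ-Solver.solve-∀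
... | inj₁ d | inj₂ e = 4∤i+j (subst (+ 4 ∣_) (lemma i j _) (ℤ∣.∣m∣n⇒∣m+n d e))
  where lemma : ∀ i j r → (i - r) + (j + r) ≡ i + j
        lemma = ℤ-Solver.solve-∀
... | inj₂ d | inj₁ e = 4∤i+j (subst (+ 4 ∣_) (lemma i j _) (ℤ∣.∣m∣n⇒∣m+n d e))
  where lemma : ∀ i j r → (i + r) + (j - r) ≡ i + j
        lemma = ℤ-Solver.solve-∀
... | inj₂ d | inj₂ e = 4∤i-j (subst (+ 4 ∣_) (lemma i j _) (ℤ∣.∣m∣n⇒∣m-n d e))
  where lemma : ∀ i j r → (i + r) - (j + r) ≡ i - j
        lemma = ℤ-Solver.solve-∀

≢⇒apart : ∀ i j → residueClass ∣ i ∣ ≢ residueClass ∣ j ∣ → Apart i j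
≢⇒apart i j r≢ = r≢ ∘ 4∣+⇒residueClass i j , r≢ ∘ 4∣-⇒residueClass i j

isVertex⇒vertexℕ : ∀ P → IsVertex P → Vertexℕ (abs³ P)
isVertex⇒vertexℕ (x , y , z) (xy₁ , xy₂ , yz₁ , yz₂ , zx₁ , zx₂) =
  apart⇒≢ x y (xy₁ , xy₂) , apart⇒≢ y z (yz₁ , yz₂) , apart⇒≢ z x (zx₁ , zx₂)

vertexℕ⇒isVertex : ∀ P → Vertexℕ (abs³ P) → IsVertex P
vertexℕ⇒isVertex (x , y , z) (x≢y , y≢z , z≢x) =
  let xy₁ , xy₂ = ≢⇒apart x y x≢y
      yz₁ , yz₂ = ≢⇒apart y z y≢z
      zx₁ , zx₂ = ≢⇒apart z x z≢x
  in xy₁ , xy₂ , yz₁ , yz₂ , zx₁ , zx₂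

-- Orderings of the coordinates

-- A constructor lists the coordinates by decreasing absolute value.
data Order : Set where
  xyz xzy yxz yzx zxy zyx : Order

-- Distributes (largest, middle, smallest) to the coordinate positions. It differs from `unplace`
-- exactly at the 3-cycles `yzx` and `zxy`.
place : {A : Set} → Order → Triple A → Triple A
place xyz (u , v , w) = u , v , w
place xzy (u , v , w) = u , w , v
place yxz (u , v , w) = v , u , w
place yzx (u , v , w) = w , u , v
place zxy (u , v , w) = v , w , u
place zyx (u , v , w) = w , v , u

unplace : {A : Set} → Order → Triple A → Triple A
unplace xyz (x , y , z) = x , y , z
unplace xzy (x , y , z) = x , z , y
unplace yxz (x , y , z) = y , x , z
unplace yzx (x , y , z) = y , z , x
unplace zxy (x , y , z) = z , x , y
unplace zyx (x , y , z) = z , y , x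

place-unplace : {A : Set} → ∀ π (t : Triple A) → place π (unplace π t) ≡ t
place-unplace xyz _ = refl
place-unplace xzy _ = refl
place-unplace yxz _ = refl
place-unplace yzx _ = refl
place-unplace zxy _ = refl
place-unplace zyx _ = refl

swap₁₂ swap₂₃ : Order → Order
swap₁₂ xyz = yxz
swap₁₂ xzy = zxy
swap₁₂ yxz = xyz
swap₁₂ yzx = zyx
swap₁₂ zxy = xzy
swap₁₂ zyx = yzx
swap₂₃ xyz = xzy
swap₂₃ xzy = xyz
swap₂₃ yxz = yzx
swap₂₃ yzx = yxz
swap₂₃ zxy = zyx
swap₂₃ zyx = zxy

-- Rereads a point whose first two values are out of order as a sorted one in the adjacent chamber.
place-swap₁₂ : {A : Set} → ∀ π (u v w : A) → place (swap₁₂ π) (v , u , w) ≡ place π (u , v , w)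
place-swap₁₂ xyz _ _ _ = refl
place-swap₁₂ xzy _ _ _ = refl
place-swap₁₂ yxz _ _ _ = refl
place-swap₁₂ yzx _ _ _ = refl
place-swap₁₂ zxy _ _ _ = refl
place-swap₁₂ zyx _ _ _ = refl

place-swap₂₃ : {A : Set} → ∀ π (u v w : A) → place (swap₂₃ π) (u , w , v) ≡ place π (u , v , w)
place-swap₂₃ xyz _ _ _ = refl
place-swap₂₃ xzy _ _ _ = refl
place-swap₂₃ yxz _ _ _ = refl
place-swap₂₃ yzx _ _ _ = refl
place-swap₂₃ zxy _ _ _ = refl
place-swap₂₃ zyx _ _ _ = refl

abs³-place : ∀ π t → abs³ (place π t) ≡ place π (abs³ t)
abs³-place xyz _ = refl
abs³-place xzy _ = refl
abs³-place yxz _ = refl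
abs³-place yzx _ = refl
abs³-place zxy _ = refl
abs³-place zyx _ = refl

vertexℕ-place⁺ : ∀ π {t} → Vertexℕ t → Vertexℕ (place π t)
vertexℕ-place⁺ xyz (a , b , c) = a , b , c
vertexℕ-place⁺ xzy (a , b , c) = ≢-sym c , ≢-sym b , ≢-sym a
vertexℕ-place⁺ yxz (a , b , c) = ≢-sym a , ≢-sym c , ≢-sym b
vertexℕ-place⁺ yzx (a , b , c) = c , a , b
vertexℕ-place⁺ zxy (a , b , c) = b , c , a
vertexℕ-place⁺ zyx (a , b , c) = ≢-sym b , ≢-sym a , ≢-sym c

vertexℕ-place⁻ : ∀ π {t} → Vertexℕ (place π t) → Vertexℕ t
vertexℕ-place⁻ xyz (a , b , c) = a , b , c
vertexℕ-place⁻ xzy (a , b , c) = ≢-sym c , ≢-sym b , ≢-sym a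
vertexℕ-place⁻ yxz (a , b , c) = ≢-sym a , ≢-sym c , ≢-sym b
vertexℕ-place⁻ yzx (a , b , c) = b , c , a
vertexℕ-place⁻ zxy (a , b , c) = c , a , b
vertexℕ-place⁻ zyx (a , b , c) = ≢-sym b , ≢-sym a , ≢-sym c

isVertex-place⁺ : ∀ π {t} → Vertexℕ (abs³ t) → IsVertex (place π t)
isVertex-place⁺ π {t} v =
  vertexℕ⇒isVertex (place π t) (subst Vertexℕ (sym (abs³-place π t)) (vertexℕ-place⁺ π v))

isVertex-place⁻ : ∀ π {t} → IsVertex (place π t) → Vertexℕ (abs³ t)
isVertex-place⁻ π {t} v =
  vertexℕ-place⁻ π (subst Vertexℕ (abs³-place π t) (isVertex⇒vertexℕ (place π t) v))

distance²-place : ∀ π s t → distance² (place π s) (place π t) ≡ distance² s t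
distance²-place π (u , v , w) (u′ , v′ , w′) = sum π
  where
  sq : ℤ → ℤ → ℤ
  sq i j = (i - j) * (i - j)
  acb : ∀ a b c → (a + c) + b ≡ (a + b) + c
  acb = ℤ-Solver.solve-∀
  bac : ∀ a b c → (b + a) + c ≡ (a + b) + c
  bac = ℤ-Solver.solve-∀
  cab : ∀ a b c → (c + a) + b ≡ (a + b) + c
  cab = ℤ-Solver.solve-∀
  bca : ∀ a b c → (b + c) + a ≡ (a + b) + c
  bca = ℤ-Solver.solve-∀
  cba : ∀ a b c → (c + b) + a ≡ (a + b) + c
  cba = ℤ-Solver.solve-∀
  sum : ∀ π → distance² (place π (u , v , w)) (place π (u′ , v′ , w′)) ≡
              distance² (u , v , w) (u′ , v′ , w′)
  sum xyz = refl
  sum xzy = acb (sq u u′) (sq v v′) (sq w w′)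
  sum yxz = bac (sq u u′) (sq v v′) (sq w w′)
  sum yzx = cab (sq u u′) (sq v v′) (sq w w′)
  sum zxy = bca (sq u u′) (sq v v′) (sq w w′)
  sum zyx = cba (sq u u′) (sq v v′) (sq w w′)

-- Edges

square : ∀ i → i * i ≡ + (∣ i ∣ ℕ.* ∣ i ∣)
square (+ n)    = sym (ℤ.pos-* n n)
square -[1+ n ] = refl

distance²-abs : ∀ x y z x′ y′ z′ →
  let l = ∣ x - x′ ∣ ; m = ∣ y - y′ ∣ ; n = ∣ z - z′ ∣ in
  distance² (x , y , z) (x′ , y′ , z′) ≡ + (l ℕ.* l ℕ.+ m ℕ.* m ℕ.+ n ℕ.* n)
distance²-abs x y z x′ y′ z′ =
  cong₂ ℤ._+_ (cong₂ ℤ._+_ (square (x - x′)) (square (y - y′))) (square (z - z′))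

-- Both alternatives are differences, so that `i-[i-k]` cancels them directly.
go-± : ∀ d i → go d i ≡ i - -1ℤ ⊎ go d i ≡ i - 1ℤ
go-± outward (+ n)        = inj₁ (cong +_ (ℕ.+-comm 1 n))
go-± outward -[1+ n ]     = inj₂ (cong (λ k → -[1+ suc k ]) (sym (ℕ.+-identityʳ n)))
go-± inward  +0           = inj₂ refl
go-± inward  +[1+ n ]     = inj₂ refl
go-± inward  -[1+ zero ]  = inj₁ refl
go-± inward  -[1+ suc n ] = inj₁ refl

pred-go : ∀ i → ∃[ d ] go d i ≡ i - 1ℤ
pred-go +0       = inward , refl
pred-go +[1+ n ] = inward , refl
pred-go -[1+ n ] = outward , cong (λ k → -[1+ suc k ]) (sym (ℕ.+-identityʳ n))

suc-go : ∀ i → ∃[ d ] go d i ≡ i - -1ℤ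
suc-go (+ n)        = outward , cong +_ (ℕ.+-comm 1 n)
suc-go -[1+ zero ]  = inward , refl
suc-go -[1+ suc n ] = inward , refl

i-[i-k] : ∀ i k → i - (i - k) ≡ k
i-[i-k] = ℤ-Solver.solve-∀

go-adjacent : ∀ d i → ∣ i - go d i ∣ ≡ 1
go-adjacent d i with go-± d i
... | inj₁ eq = cong ∣_∣ (trans (cong (λ j → i - j) eq) (i-[i-k] i -1ℤ))
... | inj₂ eq = cong ∣_∣ (trans (cong (λ j → i - j) eq) (i-[i-k] i 1ℤ))

adjacent⇒go : ∀ i j → ∣ i - j ∣ ≡ 1 → ∃[ d ] j ≡ go d i
adjacent⇒go i j eq with i - j in i-j
... | +[1+ 0 ] = let d , eq = pred-go i in
  d , trans (sym (i-[i-k] i j)) (trans (cong (λ k → i - k) i-j) (sym eq))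
... | -[1+ 0 ] = let d , eq = suc-go i in
  d , trans (sym (i-[i-k] i j)) (trans (cong (λ k → i - k) i-j) (sym eq))

i-i≡0 : ∀ i → ∣ i - i ∣ ≡ 0
i-i≡0 i = cong ∣_∣ (ℤ.+-inverseʳ i)

distance²-turn : ∀ m p → distance² p (turn go m p) ≡ + 2
distance²-turn (xy d e) (x , y , z)
  rewrite distance²-abs x y z (go d x) (go e y) z | go-adjacent d x | go-adjacent e y | i-i≡0 z = refl
distance²-turn (xz d e) (x , y , z)
  rewrite distance²-abs x y z (go d x) y (go e z)
        | go-adjacent d x | i-i≡0 y | go-adjacent e z = refl
distance²-turn (yz d e) (x , y , z)
  rewrite distance²-abs x y z x (go d y) (go e z)
        | i-i≡0 x | go-adjacent d y | go-adjacent e z = refl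

-- Each square is at most 2, so each root is 0 or 1 and eight cases remain.
square-sum-2 : ∀ l m n → l ℕ.* l ℕ.+ m ℕ.* m ℕ.+ n ℕ.* n ≡ 2 →
  (l ≡ 1 × m ≡ 1 × n ≡ 0) ⊎ (l ≡ 1 × m ≡ 0 × n ≡ 1) ⊎ (l ≡ 0 × m ≡ 1 × n ≡ 1)
square-sum-2 l m n eq =
  search (small l (subst (l ℕ.* l ℕ.≤_) eq (ℕ.m≤n⇒m≤n+o (n ℕ.* n) (ℕ.m≤m+n _ _))))
         (small m (subst (m ℕ.* m ℕ.≤_) eq (ℕ.m≤n⇒m≤n+o (n ℕ.* n) (ℕ.m≤n+m _ _))))
         (small n (subst (n ℕ.* n ℕ.≤_) eq (ℕ.m≤n+m _ _))) eq
  where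
  small : ∀ k → k ℕ.* k ℕ.≤ 2 → k ℕ.< 2
  small k k²≤2 = ℕ.≰⇒> λ 2≤k → ℕ.<⇒≱ (from-yes (2 ℕ.<? 4)) (ℕ.≤-trans (ℕ.*-mono-≤ 2≤k 2≤k) k²≤2)

  search : ∀ {l m n} → l ℕ.< 2 → m ℕ.< 2 → n ℕ.< 2 → l ℕ.* l ℕ.+ m ℕ.* m ℕ.+ n ℕ.* n ≡ 2 →
    (l ≡ 1 × m ≡ 1 × n ≡ 0) ⊎ (l ≡ 1 × m ≡ 0 × n ≡ 1) ⊎ (l ≡ 0 × m ≡ 1 × n ≡ 1)
  search {1} {1} {0} _ _ _ _ = inj₁ (refl , refl , refl)
  search {1} {0} {1} _ _ _ _ = inj₂ (inj₁ (refl , refl , refl))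
  search {0} {1} {1} _ _ _ _ = inj₂ (inj₂ (refl , refl , refl))
  search {0} {0} {0} _ _ _ ()
  search {0} {0} {1} _ _ _ ()
  search {0} {1} {0} _ _ _ ()
  search {1} {0} {0} _ _ _ ()
  search {1} {1} {1} _ _ _ ()
  search {suc (suc _)} (s≤s (s≤s ())) _ _ _
  search {_} {suc (suc _)} _ (s≤s (s≤s ())) _ _
  search {_} {_} {suc (suc _)} _ _ (s≤s (s≤s ())) _

∣i-j∣≡0⇒j≡i : ∀ i j → ∣ i - j ∣ ≡ 0 → j ≡ i
∣i-j∣≡0⇒j≡i i j eq = sym (ℤ.i-j≡0⇒i≡j i j (ℤ.∣i∣≡0⇒i≡0 eq))

-- Together with `distance²-turn`, this identifies the edges with the turns between vertices.
distance²≡2⇒turn : ∀ p q → distance² p q ≡ + 2 → ∃[ m ] q ≡ turn go m p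
distance²≡2⇒turn (x , y , z) (x′ , y′ , z′) eq
  with square-sum-2 _ _ _ (ℤ.+-injective (trans (sym (distance²-abs x y z x′ y′ z′)) eq))
... | inj₁ (l , m , n) with refl ← ∣i-j∣≡0⇒j≡i z z′ n =
  let d , x′≡ = adjacent⇒go x x′ l ; e , y′≡ = adjacent⇒go y y′ m
  in xy d e , cong₂ (λ i j → i , j , z) x′≡ y′≡
... | inj₂ (inj₁ (l , m , n)) with refl ← ∣i-j∣≡0⇒j≡i y y′ m =
  let d , x′≡ = adjacent⇒go x x′ l ; e , z′≡ = adjacent⇒go z z′ n
  in xz d e , cong₂ (λ i j → i , y , j) x′≡ z′≡
... | inj₂ (inj₂ (l , m , n)) with refl ← ∣i-j∣≡0⇒j≡i x x′ l =
  let d , y′≡ = adjacent⇒go y y′ m ; e , z′≡ = adjacent⇒go z z′ n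
  in yz d e , cong₂ (λ i j → x , i , j) y′≡ z′≡

-- The value of h

-- The numerator y - s is odd only if x and y are both odd. Both then have class 1, which the
-- hypothesis excludes.
half-spec : ∀ x y → residueClass x ≢ residueClass y →
            + y - a (y mod 4) * b (x mod 4) ≡ + 2 * + half x y
half-spec x (suc (suc (suc (suc y)))) x≢y =
  trans (ℤ.+-assoc (+ 4) (+ y) (- (a (y mod 4) * b (x mod 4))))
    (trans (cong (λ k → + 4 + k) (half-spec x y x≢y)) (four+ (+ half x y)))
  where
  four+ : ∀ k → + 4 + + 2 * k ≡ + 2 * (+ 2 + k)
  four+ = ℤ-Solver.solve-∀
half-spec (suc (suc (suc (suc x)))) 0 x≢y = half-spec x 0 x≢y
half-spec (suc (suc (suc (suc x)))) 1 x≢y = half-spec x 1 x≢y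
half-spec (suc (suc (suc (suc x)))) 2 x≢y = half-spec x 2 x≢y
half-spec (suc (suc (suc (suc x)))) 3 x≢y = half-spec x 3 x≢y
half-spec x 0 x≢y = refl
half-spec x 2 x≢y = refl
half-spec 0 1 x≢y = refl
half-spec 0 3 x≢y = refl
half-spec 2 1 x≢y = refl
half-spec 2 3 x≢y = refl
half-spec 1 1 x≢y = contradiction refl x≢y
half-spec 1 3 x≢y = contradiction refl x≢y
half-spec 3 1 x≢y = contradiction refl x≢y
half-spec 3 3 x≢y = contradiction refl x≢y

-- Copies of the local `x′` and `y′` of `h′`, which cannot be named from outside.
max mid : Triple ℕ → ℕ
max (x , y , z) = x ℕ.⊔ y ℕ.⊔ z
mid (x , y , z) = (x ℕ.⊓ y) ℕ.⊔ ((x ℕ.⊔ y) ℕ.⊓ z)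

max-mid-place : ∀ π {t} → Descending t →
                max (place π t) ≡ proj₁ t × mid (place π t) ≡ proj₁ (proj₂ t)
max-mid-place π {u , v , w} (v<u , w<v) = cases π
  where
  v≤u = ℕ.<⇒≤ v<u
  w≤v = ℕ.<⇒≤ w<v
  w≤u = ℕ.≤-trans w≤v v≤u
  cases : ∀ π → max (place π (u , v , w)) ≡ u × mid (place π (u , v , w)) ≡ v
  cases xyz rewrite ℕ.m≥n⇒m⊔n≡m v≤u | ℕ.m≥n⇒m⊓n≡n v≤u | ℕ.m≥n⇒m⊓n≡n w≤u =
    ℕ.m≥n⇒m⊔n≡m w≤u , ℕ.m≥n⇒m⊔n≡m w≤v
  cases xzy rewrite ℕ.m≥n⇒m⊔n≡m w≤u | ℕ.m≥n⇒m⊓n≡n w≤u | ℕ.m≥n⇒m⊓n≡n v≤u =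
    ℕ.m≥n⇒m⊔n≡m v≤u , ℕ.m≤n⇒m⊔n≡n w≤v
  cases yxz rewrite ℕ.m≤n⇒m⊔n≡n v≤u | ℕ.m≤n⇒m⊓n≡m v≤u | ℕ.m≥n⇒m⊓n≡n w≤u =
    ℕ.m≥n⇒m⊔n≡m w≤u , ℕ.m≥n⇒m⊔n≡m w≤v
  cases yzx rewrite ℕ.m≤n⇒m⊔n≡n w≤u | ℕ.m≤n⇒m⊓n≡m w≤u | ℕ.m≥n⇒m⊓n≡n v≤u =
    ℕ.m≥n⇒m⊔n≡m v≤u , ℕ.m≤n⇒m⊔n≡n w≤v
  cases zxy rewrite ℕ.m≥n⇒m⊔n≡m w≤v | ℕ.m≥n⇒m⊓n≡n w≤v | ℕ.m≤n⇒m⊓n≡m v≤u =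
    ℕ.m≤n⇒m⊔n≡n v≤u , ℕ.m≤n⇒m⊔n≡n w≤v
  cases zyx rewrite ℕ.m≤n⇒m⊔n≡n w≤v | ℕ.m≤n⇒m⊓n≡m w≤v | ℕ.m≤n⇒m⊓n≡m v≤u =
    ℕ.m≤n⇒m⊔n≡n v≤u , ℕ.m≤n⇒m⊔n≡n w≤v

-- The signs are those of the largest and the middle coordinate.
level : Order → Sign → Sign → ℕ
level xyz _      _      = 3
level xzy _      Sign.+ = 2
level xzy _      Sign.- = 4
level yxz Sign.+ _      = 2
level yxz Sign.- _      = 4
level yzx Sign.+ Sign.+ = 1
level yzx Sign.- Sign.- = 5
level yzx Sign.+ Sign.- = 3
level yzx Sign.- Sign.+ = 3
level zxy Sign.+ _      = 1
level zxy Sign.- _      = 5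
level zyx Sign.+ Sign.+ = 0
level zyx Sign.+ Sign.- = 2
level zyx Sign.- Sign.+ = 4
level zyx Sign.- Sign.- = 6

c-place : ∀ π u v w → Descending (abs³ (u , v , w)) →
          c (place π (u , v , w)) ≡ + level π (sign u) (sign v) - + 3
c-place π u v w (v<u , w<v) = cases π
  where
  w<u : ∣ w ∣ ℕ.< ∣ u ∣
  w<u = ℕ.<-trans w<v v<u

  nonzero : ∀ {i j} → ∣ j ∣ ℕ.< ∣ i ∣ → i ≢ 0ℤ
  nonzero () refl

  u≢0 = nonzero {u} {v} v<u
  v≢0 = nonzero {v} {w} w<v

  -- What remains of `c` in the chamber `yzx`, where y is `u` and z is `v`, once the comparisons are
  -- decided. In `vu`, for `zyx`, y is `v` and z is `u`.
  uv : ∀ u v → u ≢ 0ℤ → v ≢ 0ℤ →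
       (if does (u * v ℤ.≤? 0ℤ) then 0ℤ else
        if does (0ℤ ℤ.≤? u * v) then - (+ 2 * sig v) else - (+ 3 * sig u))
       ≡ + level yzx (sign u) (sign v) - + 3
  uv +0       _        u≢0 _   = contradiction refl u≢0
  uv _        +0       _   v≢0 = contradiction refl v≢0
  uv +[1+ _ ] +[1+ _ ] _   _   = refl
  uv +[1+ _ ] -[1+ _ ] _   _   = refl
  uv -[1+ _ ] +[1+ _ ] _   _   = refl
  uv -[1+ _ ] -[1+ _ ] _   _   = refl

  vu : ∀ u v → u ≢ 0ℤ → v ≢ 0ℤ →
       (if does (v * u ℤ.≤? 0ℤ) then - sig u else - (+ 3 * sig v))
       ≡ + level zyx (sign u) (sign v) - + 3
  vu +0       _        u≢0 _   = contradiction refl u≢0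
  vu _        +0       _   v≢0 = contradiction refl v≢0
  vu +[1+ _ ] +[1+ _ ] _   _   = refl
  vu +[1+ _ ] -[1+ _ ] _   _   = refl
  vu -[1+ _ ] +[1+ _ ] _   _   = refl
  vu -[1+ _ ] -[1+ _ ] _   _   = refl

  one-sign : ∀ u s → u ≢ 0ℤ →
    (- sig u ≡ + level xzy s (sign u) - + 3) ×
    (- sig u ≡ + level yxz (sign u) s - + 3) ×
    (- (+ 2 * sig u) ≡ + level zxy (sign u) s - + 3)
  one-sign +0       _ u≢0 = contradiction refl u≢0
  one-sign +[1+ _ ] _ _   = refl , refl , refl
  one-sign -[1+ _ ] _ _   = refl , refl , refl

  u≥v = dec-true  (∣ u ∣ ℕ.≥? ∣ v ∣) (ℕ.<⇒≤ v<u)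
  u≥w = dec-true  (∣ u ∣ ℕ.≥? ∣ w ∣) (ℕ.<⇒≤ w<u)
  v≥w = dec-true  (∣ v ∣ ℕ.≥? ∣ w ∣) (ℕ.<⇒≤ w<v)
  v≱u = dec-false (∣ v ∣ ℕ.≥? ∣ u ∣) (ℕ.<⇒≱ v<u)
  w≱u = dec-false (∣ w ∣ ℕ.≥? ∣ u ∣) (ℕ.<⇒≱ w<u)
  w≱v = dec-false (∣ w ∣ ℕ.≥? ∣ v ∣) (ℕ.<⇒≱ w<v)

  cases : ∀ π → c (place π (u , v , w)) ≡ + level π (sign u) (sign v) - + 3
  cases xyz rewrite u≥v | v≥w = refl
  cases xzy rewrite w≱v | u≥v | u≥w | v≥w = proj₁ (one-sign v (sign u) v≢0)
  cases yxz rewrite v≱u | v≥w | w≱u | u≥v = proj₁ (proj₂ (one-sign u (sign v) u≢0))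
  cases yzx rewrite w≱u | w≱v | u≥w | u≥v | v≥w | v≱u = uv u v u≢0 v≢0
  cases zxy rewrite v≱u | w≱u | v≥w | w≱v | u≥v = proj₂ (proj₂ (one-sign u (sign v) u≢0))
  cases zyx rewrite w≱u | w≱v | v≱u | u≥v | u≥w | v≥w = vu u v u≢0 v≢0

-- Over unnormalised rationals the right side is literally a fraction with denominator 1 · 2 · 2 · 1
-- = 4, so the claim becomes an integer identity and no gcd has to be computed.
rational-sum : ∀ p q r t n → + 2 * n ≡ + 2 * p + (q - r) + + 2 * t →
               n / 1 ≡ ((p / 1) ℚ.+ (q / 2) ℚ.- (r / 2)) ℚ.+ (t / 1)
rational-sum p q r t n eq = ℚ.toℚᵘ-injective (ℚᵘ.≃-trans (of n 0) (ℚᵘ.≃-trans (*≡* scaled) (ℚᵘ.≃-sym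
  (ℚᵘ.≃-trans (ℚ.toℚᵘ-homo-+ ((p / 1) ℚ.+ (q / 2) ℚ.- (r / 2)) (t / 1)) (ℚᵘ.+-cong
    (ℚᵘ.≃-trans (ℚ.toℚᵘ-homo-+ ((p / 1) ℚ.+ (q / 2)) (ℚ.- (r / 2))) (ℚᵘ.+-cong
      (ℚᵘ.≃-trans (ℚ.toℚᵘ-homo-+ (p / 1) (q / 2)) (ℚᵘ.+-cong (of p 0) (of q 1)))
      (ℚᵘ.≃-trans (ℚ.toℚᵘ-homo‿- (r / 2)) (ℚᵘ.-‿cong (of r 1)))))
    (of t 0))))))
  where
  of : ∀ i d → toℚᵘ (i / suc d) ≃ mkℚᵘ i d
  of i d = ℚ.toℚᵘ-fromℚᵘ (mkℚᵘ i d)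

  expand : ∀ p q r t → + 2 * (+ 2 * p + (q - r) + + 2 * t) ≡
           (((p * + 2 + q * 1ℤ) * + 2 + (- r) * + 2) * 1ℤ + t * + 4) * 1ℤ
  expand = ℤ-Solver.solve-∀

  double : ∀ n → n * + 4 ≡ + 2 * (+ 2 * n)
  double = ℤ-Solver.solve-∀

  scaled : n * + 4 ≡ (((p * + 2 + q * 1ℤ) * + 2 + (- r) * + 2) * 1ℤ + t * + 4) * 1ℤ
  scaled = trans (double n) (trans (cong (λ k → + 2 * k) eq) (expand p q r t))

-- At a vertex the index is h + 3. The offset keeps it natural, as `c` can be as low as -3.
data Ordered : Point → ℕ → Set where
  ordered : ∀ π u v w → Descending (abs³ (u , v , w)) →
            Ordered (place π (u , v , w)) (height (abs³ (u , v , w)) ℕ.+ level π (sign u) (sign v))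

-- As h depends on the point alone, this also serves to compare indices obtained from different
-- `Ordered` proofs.
h-ordered : ∀ {P} m n → Ordered P m → (v : IsVertex P) → n ℕ.+ 3 ≡ m → + n / 1 ≡ h (P , [ v ])
h-ordered _ n (ordered π u v w desc) vertex eq
  = rational-sum (+ max t) (+ mid t) (s (max t) (mid t)) (c p) (+ n) (begin
      + 2 * + n
        ≡⟨ twice (+ n) ⟩
      + 2 * (+ (n ℕ.+ 3) - + 3)
        ≡⟨ cong (λ m → + 2 * (+ m - + 3)) eq ⟩
      + 2 * (+ X + + half X Y + + l - + 3)
        ≡⟨ split (+ X) (+ half X Y) (+ l) ⟩
      + 2 * + X + + 2 * + half X Y + + 2 * (+ l - + 3)
        ≡⟨ cong₂ (λ i j → + 2 * + X + i + + 2 * j)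
             (half-spec X Y (proj₁ (isVertex-place⁻ π vertex))) (c-place π u v w desc) ⟨
      + 2 * + X + (+ Y - s X Y) + + 2 * c p
        ≡⟨ cong₂ (λ i j → + 2 * + i + (+ j - s i j) + + 2 * c p) max≡ mid≡ ⟨
      + 2 * + max t + (+ mid t - s (max t) (mid t)) + + 2 * c p  ∎)
  where
  open ≡-Reasoning
  p = place π (u , v , w)
  t = abs³ p
  X = ∣ u ∣
  Y = ∣ v ∣
  l = level π (sign u) (sign v)
  s : ℕ → ℕ → ℤ
  s x y = a (y mod 4) * b (x mod 4)
  max≡ : max t ≡ X
  max≡ = trans (cong max (abs³-place π (u , v , w))) (proj₁ (max-mid-place π desc))
  mid≡ : mid t ≡ Y
  mid≡ = trans (cong mid (abs³-place π (u , v , w))) (proj₂ (max-mid-place π desc))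
  twice : ∀ n → + 2 * n ≡ + 2 * (n + + 3 - + 3)
  twice = ℤ-Solver.solve-∀
  split : ∀ x k l → + 2 * (x + k + l - + 3) ≡ + 2 * x + + 2 * k + + 2 * (l - + 3)
  split = ℤ-Solver.solve-∀

-- Upper bound

Reach : Point → ℕ → Set
Reach P n = Σ[ vertex ∈ IsVertex P ] ∃[ w ] walkLength _~_ {O} {P , [ vertex ]} w ≡ n

walkLength-◅◅ : ∀ {P Q R : V} (w : Walk _~_ P Q) (w′ : Walk _~_ Q R) →
                walkLength _~_ (w ◅◅ w′) ≡ walkLength _~_ w ℕ.+ walkLength _~_ w′
walkLength-◅◅ ε       w′ = refl
walkLength-◅◅ (e ◅ w) w′ = cong suc (walkLength-◅◅ w w′)

extend : ∀ {P Q n} → Reach P n → IsVertex Q → distance² P Q ≡ + 2 → Reach Q (suc n)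
extend {P} {Q} {n} (_ , w , eq) vertex adjacent = vertex , w ◅◅ (adjacent ◅ ε) ,
  trans (walkLength-◅◅ w (adjacent ◅ ε)) (trans (ℕ.+-comm _ 1) (cong suc eq))

-- The 24 vertices of the truncated octahedron around the origin.
core : Order → Sign → Sign → Point
core π s t = place π (s ◃ 2 , t ◃ 1 , +0)

isVertex-core : ∀ π {t} → abs³ t ≡ (2 , 1 , 0) → IsVertex (place π t)
isVertex-core π {t} eq = isVertex-place⁺ π {t}
  (subst Vertexℕ (sym eq) (from-yes (vertexℕ? (2 , 1 , 0))))

-- The signs trade places because each stays with its coordinate while the ranks are exchanged.
reach-swap₁₂ : ∀ π s t {n} → Reach (core π s t) n → Reach (core (swap₁₂ π) t s) (suc n)
reach-swap₁₂ π s t r = extend r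
  (isVertex-core (swap₁₂ π) (cong₂ (λ i j → i , j , 0) (ℤ.abs-◃ t 2) (ℤ.abs-◃ s 1)))
  (trans (cong (distance² (core π s t)) (place-swap₁₂ π (s ◃ 1) (t ◃ 2) +0))
    (trans (distance²-place π (s ◃ 2 , t ◃ 1 , +0) (s ◃ 1 , t ◃ 2 , +0)) (adjacent s t)))
  where
  adjacent : ∀ s t → distance² (s ◃ 2 , t ◃ 1 , +0) (s ◃ 1 , t ◃ 2 , +0) ≡ + 2
  adjacent Sign.+ Sign.+ = refl
  adjacent Sign.+ Sign.- = refl
  adjacent Sign.- Sign.+ = refl
  adjacent Sign.- Sign.- = refl

-- The middle coordinate drops to 0 and loses its sign `t`, while the former zero may become 1 or
-- -1, so `u` is free.
reach-swap₂₃ : ∀ π s t u {n} → Reach (core π s t) n → Reach (core (swap₂₃ π) s u) (suc n)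
reach-swap₂₃ π s t u r = extend r
  (isVertex-core (swap₂₃ π) (cong₂ (λ i j → i , j , 0) (ℤ.abs-◃ s 2) (ℤ.abs-◃ u 1)))
  (trans (cong (distance² (core π s t)) (place-swap₂₃ π (s ◃ 2) +0 (u ◃ 1)))
    (trans (distance²-place π (s ◃ 2 , t ◃ 1 , +0) (s ◃ 2 , +0 , u ◃ 1)) (adjacent s t u)))
  where
  adjacent : ∀ s t u → distance² (s ◃ 2 , t ◃ 1 , +0) (s ◃ 2 , +0 , u ◃ 1) ≡ + 2
  adjacent Sign.+ Sign.+ Sign.+ = refl
  adjacent Sign.+ Sign.- Sign.+ = refl
  adjacent Sign.- Sign.+ Sign.+ = refl
  adjacent Sign.- Sign.- Sign.+ = refl
  adjacent Sign.+ Sign.+ Sign.- = refl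
  adjacent Sign.+ Sign.- Sign.- = refl
  adjacent Sign.- Sign.+ Sign.- = refl
  adjacent Sign.- Sign.- Sign.- = refl

-- The level is also an argument, so that the recursion is structural.
reach-core : ∀ n π s t → level π s t ≡ n → Reach (core π s t) n
-- This core point is (0, 1, 2), that is, `O` itself.
reach-core .0 zyx Sign.+ Sign.+ refl = from-yes (isVertex? (value O)) , ε , refl
reach-core .1 yzx Sign.+ Sign.+ refl =
  reach-swap₁₂ zyx Sign.+ Sign.+ (reach-core 0 zyx Sign.+ Sign.+ refl)
reach-core .1 zxy Sign.+ t      refl =
  reach-swap₂₃ zyx Sign.+ Sign.+ t (reach-core 0 zyx Sign.+ Sign.+ refl)
reach-core .2 zyx Sign.+ Sign.- refl =
  reach-swap₂₃ zxy Sign.+ Sign.+ Sign.- (reach-core 1 zxy Sign.+ Sign.+ refl)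
reach-core .2 xzy s      Sign.+ refl =
  reach-swap₁₂ zxy Sign.+ s (reach-core 1 zxy Sign.+ s refl)
reach-core .2 yxz Sign.+ t      refl =
  reach-swap₂₃ yzx Sign.+ Sign.+ t (reach-core 1 yzx Sign.+ Sign.+ refl)
-- The middle sign of the predecessor is lost along the edge, so it can be chosen as `+`, which
-- gives level 2.
reach-core .3 xyz s      t      refl =
  reach-swap₂₃ xzy s Sign.+ t (reach-core 2 xzy s Sign.+ refl)
reach-core .3 yzx Sign.+ Sign.- refl =
  reach-swap₂₃ yxz Sign.+ Sign.+ Sign.- (reach-core 2 yxz Sign.+ Sign.+ refl)
reach-core .3 yzx Sign.- Sign.+ refl =
  reach-swap₁₂ zyx Sign.+ Sign.- (reach-core 2 zyx Sign.+ Sign.- refl)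
reach-core .4 xzy s      Sign.- refl =
  reach-swap₂₃ xyz s Sign.+ Sign.- (reach-core 3 xyz s Sign.+ refl)
reach-core .4 yxz Sign.- t      refl =
  reach-swap₁₂ xyz t Sign.- (reach-core 3 xyz t Sign.- refl)
reach-core .4 zyx Sign.- Sign.+ refl =
  reach-swap₁₂ yzx Sign.+ Sign.- (reach-core 3 yzx Sign.+ Sign.- refl)
reach-core .5 zxy Sign.- t      refl =
  reach-swap₁₂ xzy t Sign.- (reach-core 4 xzy t Sign.- refl)
reach-core .5 yzx Sign.- Sign.- refl =
  reach-swap₂₃ yxz Sign.- Sign.+ Sign.- (reach-core 4 yxz Sign.- Sign.+ refl)
reach-core .6 zyx Sign.- Sign.- refl =
  reach-swap₂₃ zxy Sign.- Sign.+ Sign.- (reach-core 5 zxy Sign.- Sign.+ refl)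

height-positive : ∀ {t} → Descending t → height t ≢ 0
height-positive {suc _ , _ , _} _ ()

distance²-sym : ∀ p q → distance² p q ≡ distance² q p
distance²-sym (x , y , z) (x′ , y′ , z′) = lemma x y z x′ y′ z′
  where
  lemma : ∀ x y z x′ y′ z′ →
    (x - x′) * (x - x′) + (y - y′) * (y - y′) + (z - z′) * (z - z′) ≡
    (x′ - x) * (x′ - x) + (y′ - y) * (y′ - y) + (z′ - z) * (z′ - z)
  lemma = ℤ-Solver.solve-∀

-- The two larger absolute values are positive at both ends, so the level is constant along edges
-- inside a chamber.
turn-sign : ∀ m p → let q = turn go m p in Descending (abs³ p) → Descending (abs³ q) →
            sign (proj₁ q) ≡ sign (proj₁ p) × sign (proj₁ (proj₂ q)) ≡ sign (proj₁ (proj₂ p))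
turn-sign m (u , v , w) (v<u , w<v) (v′<u′ , w′<v′) =
  let same-u , same-v = turn-sameSign m u v w
  in same-u (ℕ.m<n⇒n≢0 v<u) (ℕ.m<n⇒n≢0 v′<u′) , same-v (ℕ.m<n⇒n≢0 w<v) (ℕ.m<n⇒n≢0 w′<v′)

reach-descending : ∀ k π (p : Point) → let (u , v , _) = p in
  height (abs³ p) ≡ k → Descending (abs³ p) → IsVertex (place π p) →
  ∃[ n ] Reach (place π p) n × n ℕ.+ 3 ≡ k ℕ.+ level π (sign u) (sign v)
reach-descending zero π p eq desc _ = contradiction eq (height-positive desc)
reach-descending (suc k) π p@(u , v , w) eq desc vertex
  with descentOrCore (abs³ p) desc (isVertex-place⁻ π {p} vertex)
-- The core has height 2 + 1 = 3, which is exactly the offset, so the walk length is the level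
-- alone.
... | inj₁ at-core =
  l , subst (λ t → Reach (place π t) l) (sym p≡core) (reach-core l π (sign u) (sign v) refl) ,
  trans (ℕ.+-comm l 3) (cong (ℕ._+ l) (trans (sym (cong height at-core)) eq))
  where
  l = level π (sign u) (sign v)
  as-◃ : ∀ i {n} → ∣ i ∣ ≡ n → i ≡ sign i ◃ n
  as-◃ i refl = sym (ℤ.signᵢ◃∣i∣≡i i)
  p≡core : p ≡ (sign u ◃ 2 , sign v ◃ 1 , +0)
  p≡core = cong₂ _,_ (as-◃ u (cong proj₁ at-core))
    (cong₂ _,_ (as-◃ v (cong (proj₁ ∘ proj₂) at-core)) (ℤ.∣i∣≡0⇒i≡0 (cong (proj₂ ∘ proj₂) at-core)))
-- A walk to the lower neighbour `q` in the same chamber is extended by the edge back to `p`.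
... | inj₂ (m , vertexℕ , descℕ , height≡) =
  let n , reach , n+3≡ = reach-descending k π q height-q desc′
        (isVertex-place⁺ π {q} (subst Vertexℕ (sym abs-q) vertexℕ))
  in suc n , extend reach vertex adjacent ,
     cong suc (trans n+3≡ (cong₂ (λ s t → k ℕ.+ level π s t) (proj₁ same-signs) (proj₂ same-signs)))
  where
  q = turn go m p
  abs-q : abs³ q ≡ turn goℕ m (abs³ p)
  abs-q = abs³-turn m p
  desc′ : Descending (abs³ q)
  desc′ = subst Descending (sym abs-q) descℕ
  same-signs = turn-sign m p desc desc′
  height-q : height (abs³ q) ≡ k
  height-q = trans (cong height abs-q) (ℕ.suc-injective (trans (sym height≡) eq))
  adjacent : distance² (place π q) (place π p) ≡ + 2
  adjacent = trans (distance²-place π q p) (trans (distance²-sym q p) (distance²-turn m p))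

-- Lower bound

allSigns? : {P : Sign → Set} → (∀ s → Dec (P s)) → Dec (∀ s → P s)
allSigns? P? = map′ (λ { (p , n) Sign.+ → p ; (p , n) Sign.- → n })
                    (λ f → f Sign.+ , f Sign.-) (P? Sign.+ ×-dec P? Sign.-)

allOrders? : {P : Order → Set} → (∀ π → Dec (P π)) → Dec (∀ π → P π)
allOrders? P? = map′
  (λ { (p , _) xyz → p ; (_ , p , _) xzy → p ; (_ , _ , p , _) yxz → p
     ; (_ , _ , _ , p , _) yzx → p ; (_ , _ , _ , _ , p , _) zxy → p ; (_ , _ , _ , _ , _ , p) zyx → p })
  (λ f → f xyz , f xzy , f yxz , f yzx , f zxy , f zyx)
  (P? xyz ×-dec P? xzy ×-dec P? yxz ×-dec P? yzx ×-dec P? zxy ×-dec P? zyx)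

level-swap₁₂ : ∀ π s t → level (swap₁₂ π) t s ℕ.≤ suc (level π s t)
level-swap₁₂ = from-yes (allOrders? λ π → allSigns? λ s → allSigns? λ t →
  level (swap₁₂ π) t s ℕ.≤? suc (level π s t))

level-swap₂₃ : ∀ π s t u → level (swap₂₃ π) s u ℕ.≤ suc (level π s t)
level-swap₂₃ = from-yes (allOrders? λ π → allSigns? λ s → allSigns? λ t → allSigns? λ u →
  level (swap₂₃ π) s u ℕ.≤? suc (level π s t))

ordered-step : ∀ {P Q m} → Ordered P m → IsVertex P → IsVertex Q → distance² P Q ≡ + 2 →
               ∃[ n ] Ordered Q n × n ℕ.≤ suc m
ordered-step {P} {Q} (ordered π u v w desc) vertexP vertexQ adjacent
  -- `Q` is expressed in the frame of `P`, where the edge becomes a turn of the sorted triple.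
  with unplace π Q in eqQ
... | q with refl ← trans (sym (place-unplace π Q)) (cong (place π) eqQ)
  with distance²≡2⇒turn (u , v , w) q (trans (sym (distance²-place π (u , v , w) q)) adjacent)
... | m , refl with turn go m (u , v , w) in eqq
... | u′ , v′ , w′ = cases (subst (Outcome (abs³ p)) (sym abs-q)
    (outcome (abs³ p) desc (isVertex-place⁻ π {p} vertexP) m
      (subst Vertexℕ abs-q (isVertex-place⁻ π {u′ , v′ , w′} vertexQ))))
  where
  p = u , v , w
  abs-q : abs³ (u′ , v′ , w′) ≡ turn goℕ m (abs³ p)
  abs-q = trans (cong abs³ (sym eqq)) (abs³-turn m p)
  H = height (abs³ p)
  L = level π (sign u) (sign v)
  u≢0 = ℕ.m<n⇒n≢0 (proj₁ desc)
  v≢0 = ℕ.m<n⇒n≢0 (proj₂ desc)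
  same : SameSign u u′ × SameSign v v′
  same = subst (λ { (i , j , _) → SameSign u i × SameSign v j }) eqq (turn-sameSign m u v w)

  swapped : ∀ {l} → l ℕ.≤ suc L → H ℕ.+ l ℕ.≤ suc (H ℕ.+ L)
  swapped l≤ = ℕ.≤-trans (ℕ.+-monoʳ-≤ H l≤) (ℕ.≤-reflexive (ℕ.+-suc H L))

  cases : Outcome (abs³ p) (abs³ (u′ , v′ , w′)) →
          ∃[ n ] Ordered (place π (u′ , v′ , w′)) n × n ℕ.≤ suc (H ℕ.+ L)
  cases (inj₁ (desc′ , le)) =
    _ , ordered π u′ v′ w′ desc′ , ℕ.+-mono-≤ le (ℕ.≤-reflexive (cong₂ (level π)
      (proj₁ same u≢0 (ℕ.m<n⇒n≢0 (proj₁ desc′))) (proj₂ same v≢0 (ℕ.m<n⇒n≢0 (proj₂ desc′)))))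
  -- The absolute values are exchanged, but both coordinates stay nonzero and so keep their own
  -- signs.
  cases (inj₂ (inj₁ eq)) =
    _ , subst (λ Q → Ordered Q _) (place-swap₁₂ π u′ v′ w′)
          (ordered (swap₁₂ π) v′ u′ w′ (subst Descending (sym eq′) desc)) ,
    subst (λ h → h ℕ.+ level (swap₁₂ π) (sign v′) (sign u′) ℕ.≤ suc (H ℕ.+ L))
      (cong height (sym eq′))
      (swapped (ℕ.≤-trans (ℕ.≤-reflexive (cong₂ (level (swap₁₂ π))
         (proj₂ same v≢0 (u≢0 ∘ trans (sym ∣v′∣≡∣u∣))) (proj₁ same u≢0 (v≢0 ∘ trans (sym ∣u′∣≡∣v∣)))))
       (level-swap₁₂ π (sign u) (sign v))))
    where
    ∣u′∣≡∣v∣ : ∣ u′ ∣ ≡ ∣ v ∣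
    ∣u′∣≡∣v∣ = cong proj₁ eq
    ∣v′∣≡∣u∣ : ∣ v′ ∣ ≡ ∣ u ∣
    ∣v′∣≡∣u∣ = cong (proj₁ ∘ proj₂) eq
    eq′ : abs³ (v′ , u′ , w′) ≡ abs³ p
    eq′ = cong (λ { (i , j , k) → j , i , k }) eq
  -- Here `w` may have been 0, so the sign of `w′` is arbitrary; `level-swap₂₃` allows for either.
  cases (inj₂ (inj₂ eq)) =
    _ , subst (λ Q → Ordered Q _) (place-swap₂₃ π u′ v′ w′)
          (ordered (swap₂₃ π) u′ w′ v′ (subst Descending (sym eq′) desc)) ,
    subst (λ h → h ℕ.+ level (swap₂₃ π) (sign u′) (sign w′) ℕ.≤ suc (H ℕ.+ L))
      (cong height (sym eq′))
      (swapped (ℕ.≤-trans (ℕ.≤-reflexive (cong (λ s → level (swap₂₃ π) s (sign w′))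
         (proj₁ same u≢0 (u≢0 ∘ trans (sym (cong proj₁ eq))))))
       (level-swap₂₃ π (sign u) (sign v) (sign w′))))
    where
    eq′ : abs³ (u′ , w′ , v′) ≡ abs³ p
    eq′ = cong (λ { (i , j , k) → i , k , j }) eq

isVertex : (P : V) → IsVertex (value P)
isVertex (P , [ vertex ]) = recompute (isVertex? P) vertex

ordered-walk : ∀ {P Q : V} {m} (w : Walk _~_ P Q) → Ordered (value P) m →
               ∃[ n ] Ordered (value Q) n × n ℕ.≤ walkLength _~_ w ℕ.+ m
ordered-walk ε o = _ , o , ℕ.≤-refl
ordered-walk {P} {m = m} (_◅_ {j = R} e w) o =
  let k , o′ , k≤ = ordered-step o (isVertex P) (isVertex R) e
      n , o″ , n≤ = ordered-walk w o′
  in n , o″ , ℕ.≤-trans n≤ (ℕ.≤-trans (ℕ.+-monoʳ-≤ (walkLength _~_ w) k≤)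
       (ℕ.≤-reflexive (ℕ.+-suc (walkLength _~_ w) m)))

-- Choice of a chamber and comparison of the two bounds

vertexℕ⇒distinct : ∀ {t} → Vertexℕ t → Distinct t
vertexℕ⇒distinct (x≢y , y≢z , z≢x) =
  x≢y ∘ cong residueClass , y≢z ∘ cong residueClass , z≢x ∘ cong residueClass

ordered-exists : ∀ P → Distinct (abs³ P) →
                 ∃[ π ] ∃[ p ] Descending (abs³ p) × place π p ≡ P
ordered-exists (x , y , z) (x≢y , y≢z , z≢x)
  with ℕ.<-cmp ∣ x ∣ ∣ y ∣ | ℕ.<-cmp ∣ y ∣ ∣ z ∣ | ℕ.<-cmp ∣ z ∣ ∣ x ∣
... | tri≈ _ x≡y _ | _ | _ = contradiction x≡y x≢y
... | _ | tri≈ _ y≡z _ | _ = contradiction y≡z y≢z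
... | _ | _ | tri≈ _ z≡x _ = contradiction z≡x z≢x
... | tri< x<y _ _ | tri< y<z _ _ | tri< z<x _ _ =
  contradiction (ℕ.<-trans x<y (ℕ.<-trans y<z z<x)) (ℕ.<-irrefl refl)
... | tri< x<y _ _ | tri< y<z _ _ | tri> _ _ x<z = zyx , (z , y , x) , (y<z , x<y) , refl
... | tri< x<y _ _ | tri> _ _ z<y | tri< z<x _ _ = yxz , (y , x , z) , (x<y , z<x) , refl
... | tri< x<y _ _ | tri> _ _ z<y | tri> _ _ x<z = yzx , (y , z , x) , (z<y , x<z) , refl
... | tri> _ _ y<x | tri< y<z _ _ | tri< z<x _ _ = xzy , (x , z , y) , (z<x , y<z) , refl
... | tri> _ _ y<x | tri< y<z _ _ | tri> _ _ x<z = zxy , (z , x , y) , (x<z , y<x) , refl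
... | tri> _ _ y<x | tri> _ _ z<y | tri< z<x _ _ = xyz , (x , y , z) , (y<x , z<y) , refl
... | tri> _ _ y<x | tri> _ _ z<y | tri> _ _ x<z =
  contradiction (ℕ.<-trans x<z (ℕ.<-trans z<y y<x)) (ℕ.<-irrefl refl)

reach-ordered : ∀ {P m} → Ordered P m → IsVertex P → ∃[ n ] Reach P n × n ℕ.+ 3 ≡ m
reach-ordered (ordered π u v w desc) = reach-descending _ π (u , v , w) refl desc

/1-injective : ∀ m n → + m / 1 ≡ + n / 1 → m ≡ n
/1-injective m n eq with *≡* m*1≡n*1 ← ℚ.fromℚᵘ-injective {mkℚᵘ (+ m) 0} {mkℚᵘ (+ n) 0} eq =
  ℤ.+-injective (ℤ.*-cancelʳ-≡ (+ m) (+ n) 1ℤ m*1≡n*1)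

theorem1 : ∀ (P : V) → ∃[ n ] (IsGraphDistance _~_ O P n × (+ n / 1) ≡ h P)
theorem1 P = n , ((walk , length≡) , shortest) , n/1≡h
  where
  vertex = isVertex P

  some-order : ∃[ m ] Ordered (value P) m
  some-order with π , (u , v , w) , desc , refl ← ordered-exists (value P)
    (vertexℕ⇒distinct (isVertex⇒vertexℕ (value P) vertex)) = _ , ordered π u v w desc

  reached = reach-ordered (proj₂ some-order) vertex
  n       = proj₁ reached
  walk    = proj₁ (proj₂ (proj₁ (proj₂ reached)))
  length≡ = proj₂ (proj₂ (proj₁ (proj₂ reached)))

  n/1≡h : + n / 1 ≡ h P
  n/1≡h = h-ordered _ n (proj₂ some-order) vertex (proj₂ (proj₂ reached))

  shortest : ∀ w → n ℕ.≤ walkLength _~_ w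
  shortest w =
    -- `O` has height 3 and level 0, so the walk starts at index 3, the offset that is cancelled at
    -- the end.
    let k , o , k≤ = ordered-walk w (ordered zyx (+ 2) (+ 1) +0 (ℕ.≤-refl , ℕ.≤-refl))
        l , _ , l+3≡k = reach-ordered o vertex
        -- The index `k` comes from following the walk and `n` from the chosen chamber; both give
        -- the value h of the same vertex.
        n≡l = /1-injective n l (trans n/1≡h (sym (h-ordered k l o vertex l+3≡k)))
    in ℕ.+-cancelʳ-≤ 3 n (walkLength _~_ w)
         (subst (ℕ._≤ walkLength _~_ w ℕ.+ 3) (trans (sym l+3≡k) (cong (ℕ._+ 3) (sym n≡l))) k≤)
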